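{- If the infinite server problem on the real line is $\rho$-competitive, then for every $h\in\mathbb{N}$ and every $\epsilon>0$, the $(h,k)$-server problem on the real line is $(3+\epsilon)\rho$-competitive whenever $k\ge 2\lceil(1+1/\epsilon)\rho h\rceil$.
   Context: Infinite server problem on $(M,s)$: $M$ is a metric space and $s\in M$ the source; an unbounded number of servers initially reside at $s$. A finite sequence of requests (points of $M$) is revealed one by one; each must be served immediately, without knowledge of future requests, by moving some server to the requested point. The cost is the total distance traveled. On the real line the source is a fixed point (e.g. $0$). The $(h,k)$-server problem ($k\ge h$): the online algorithm has $k$ servers and is compared against an optimal offline algorithm with $h$ servers. All online algorithms are deterministic. $ALG$ is $\rho$-competitive if there is a constant $c$ independent of $\sigma$ with $ALG(\sigma)\le\rho\, OPT(\sigma)+c$ for every request sequence $\sigma$. -}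

module Defs where

open import Algebra.Bundles using (CommutativeRing)
import Algebra.Construct.NaturalChoice.Max as Max
import Algebra.Definitions as AlgebraDefinitions
import Algebra.Definitions.RawMonoid as RawMonoid
import Algebra.Properties.AbelianGroup as AbelianGroupProperties
import Algebra.Structures as AlgebraStructures
open import Data.Bool.Base using (if_then_else_)
open import Data.Fin.Base using (Fin; fromℕ<)
import Data.Fin.Properties as Fin
open import Data.Integer.Base as ℤ using (ℤ; -[1+_])
open import Data.List.Base using (List; []; _∷_; length)
open import Data.Nat.Base using (ℕ; suc; NonZero; >-nonZero⁻¹)
import Data.Nat.Properties as ℕ
open import Data.Product.Base using (_×_; _,_; ∃; ∃-syntax; proj₁; proj₂)
open import Data.Sum.Base using (inj₁; inj₂)
open import Data.Vec.Base using (Vec; []; _∷_; replicate)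
open import Function.Base using (const)
open import Function.Metric.Structures using (IsGeneralMetric)
open import Relation.Binary.Bundles using (TotalOrder)
open import Relation.Binary.Definitions using (DecidableEquality)
open import Relation.Binary.PropositionalEquality
open import Relation.Binary.Structures using (IsDecTotalOrder)
open import Relation.Nullary.Decidable.Core using (does)

------------------------------------------------------------------------
-- The real numbers, characterised (uniquely up to isomorphism) as the
-- Dedekind-complete totally ordered field.
--
-- These are the classical reals: a decidable order and suprema of
-- arbitrary predicates together imply excluded middle for Set (compare
-- the supremum of { x | x ≡ 0 or (x ≡ 1 and P) } with 0), so no instance
-- exists without classical axioms.

record RealNumbers : Set₁ where
  infixl 7 _*_
  infixl 6 _+_
  infix  8 -_
  infix  4 _≤_ _<_

  field
    ℝ       : Set
    _≤_     : ℝ → ℝ → Set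
    _+_ _*_ : ℝ → ℝ → ℝ
    -_      : ℝ → ℝ
    0# 1#   : ℝ

  _<_ : ℝ → ℝ → Set
  x < y = x ≤ y × x ≢ y

  IsUpperBound : (ℝ → Set) → ℝ → Set
  IsUpperBound P b = ∀ x → P x → x ≤ b

  -- The ε-characterisation of the supremum: no y < s is an upper bound.
  IsSup : (ℝ → Set) → ℝ → Set
  IsSup P s = IsUpperBound P s × (∀ y → y < s → ∃[ x ] P x × y < x)

  open AlgebraStructures {A = ℝ} _≡_ using (IsCommutativeRing)
  open AlgebraDefinitions {A = ℝ} _≡_ using (Invertible)

  field
    isCommutativeRing : IsCommutativeRing _+_ _*_ -_ 0# 1#
    0≢1               : 0# ≢ 1#
    invertible        : ∀ x → x ≢ 0# → Invertible 1# _*_ x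
    isDecTotalOrder   : IsDecTotalOrder _≡_ _≤_
    +-monoˡ-≤         : ∀ z {x y} → x ≤ y → x + z ≤ y + z
    *-nonNeg          : ∀ {x y} → 0# ≤ x → 0# ≤ y → 0# ≤ x * y
    complete          : (P : ℝ → Set) → ∃ P → ∃ (IsUpperBound P) → ∃ (IsSup P)

  commutativeRing : CommutativeRing _ _
  commutativeRing = record { isCommutativeRing = isCommutativeRing }

  open CommutativeRing commutativeRing public
    using ( _-_; +-assoc; +-comm; +-identityˡ; +-identityʳ; -‿inverseˡ; -‿inverseʳ
          ; +-abelianGroup; +-rawMonoid )

  open IsDecTotalOrder isDecTotalOrder public
    using (total; antisym; isTotalOrder; _≟_; _≤?_; module Eq)
    renaming (refl to ≤-refl; reflexive to ≤-reflexive; trans to ≤-trans)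

  totalOrder : TotalOrder _ _ _
  totalOrder = record { isTotalOrder = isTotalOrder }

  open Max totalOrder public using (_⊔_; ⊔-comm; ⊔-idem; ⊔-lub; x≤x⊔y; x≤y⊔x)

  open AbelianGroupProperties +-abelianGroup public
    using ()
    renaming (⁻¹-involutive to -‿involutive; ε⁻¹≈ε to -0≡0; ⁻¹-∙-comm to -‿+-comm
             ; x∙y⁻¹≈ε⇒x≈y to x-y≡0⇒x≡y)

  open RawMonoid +-rawMonoid public using () renaming (_×_ to _·_)

  fromℕ : ℕ → ℝ
  fromℕ n = n · 1#

  fromℤ : ℤ → ℝ
  fromℤ (ℤ.+ n)  = fromℕ n
  fromℤ -[1+ n ] = - fromℕ (suc n)

  IsCeiling : ℝ → ℤ → Set
  IsCeiling x m = x ≤ fromℤ m × (∀ n → x ≤ fromℤ n → m ℤ.≤ n)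

  recip : ∀ x → x ≢ 0# → ℝ
  recip x x≢0 = proj₁ (invertible x x≢0)

  0<⇒≢0 : ∀ {x} → 0# < x → x ≢ 0#
  0<⇒≢0 (_ , 0≢x) x≡0 = 0≢x (sym x≡0)

  ∣_∣ : ℝ → ℝ
  ∣ x ∣ = x ⊔ (- x)

  IsLowerBound : (ℝ → Set) → ℝ → Set
  IsLowerBound P b = ∀ x → P x → b ≤ x

  IsInf : (ℝ → Set) → ℝ → Set
  IsInf P v = IsLowerBound P v × (∀ y → v < y → ∃[ x ] P x × x < y)

  +-monoʳ-≤ : ∀ z {x y} → x ≤ y → z + x ≤ z + y
  +-monoʳ-≤ z {x} {y} x≤y = subst₂ _≤_ (+-comm x z) (+-comm y z) (+-monoˡ-≤ z x≤y)

  +-mono-≤ : ∀ {x y u v} → x ≤ y → u ≤ v → x + u ≤ y + v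
  +-mono-≤ {y = y} {u} x≤y u≤v = ≤-trans (+-monoˡ-≤ u x≤y) (+-monoʳ-≤ y u≤v)

  x+[-x+y]≡y : ∀ x y → x + (- x + y) ≡ y
  x+[-x+y]≡y x y = trans (sym (+-assoc x (- x) y))
                  (trans (cong (_+ y) (-‿inverseʳ x)) (+-identityˡ y))

  neg-antimono-≤ : ∀ {x y} → x ≤ y → - y ≤ - x
  neg-antimono-≤ {x} {y} x≤y = subst₂ _≤_
    (x+[-x+y]≡y x (- y))
    (trans (cong (y +_) (+-comm (- x) (- y))) (x+[-x+y]≡y y (- x)))
    (+-monoˡ-≤ (- x + - y) x≤y)

  neg-injective : ∀ {x y} → - x ≡ - y → x ≡ y
  neg-injective {x} {y} eq =
    trans (sym (-‿involutive x)) (trans (cong -_ eq) (-‿involutive y))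

  neg-antimono-< : ∀ {x y} → x < y → - y < - x
  neg-antimono-< (x≤y , x≢y) = neg-antimono-≤ x≤y , λ eq → x≢y (sym (neg-injective eq))

  hasInf : (P : ℝ → Set) → ∃ P → ∃ (IsLowerBound P) → ∃ (IsInf P)
  hasInf P (p , Pp) (b , b≤P) = - s , lower , approx
    where
    Q : ℝ → Set
    Q x = P (- x)

    Q-sup : ∃ (IsSup Q)
    Q-sup = complete Q (- p , subst P (sym (-‿involutive p)) Pp)
      ( - b
      , λ x Qx → subst (_≤ - b) (-‿involutive x) (neg-antimono-≤ (b≤P (- x) Qx)))

    s : ℝ
    s = proj₁ Q-sup

    lower : IsLowerBound P (- s)
    lower x Px = subst (- s ≤_) (-‿involutive x)
      (neg-antimono-≤ (proj₁ (proj₂ Q-sup) (- x) (subst P (sym (-‿involutive x)) Px)))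

    approx : ∀ y → - s < y → ∃[ x ] P x × x < y
    approx y -s<y
      with x , Qx , -y<x ← proj₂ (proj₂ Q-sup) (- y)
                             (subst (- y <_) (-‿involutive s) (neg-antimono-< -s<y))
      = - x , Qx , subst (- x <_) (-‿involutive y) (neg-antimono-< -y<x)

  inf : (P : ℝ → Set) → ∃ P → ∃ (IsLowerBound P) → ℝ
  inf P ne bd = proj₁ (hasInf P ne bd)

------------------------------------------------------------------------

record MetricSpace (R : RealNumbers) : Set₁ where
  open RealNumbers R
  field
    Point           : Set
    d               : Point → Point → ℝ
    isGeneralMetric : IsGeneralMetric _≡_ _≡_ _≤_ 0# _+_ d

  open IsGeneralMetric isGeneralMetric public using (nonNegative; ≈⇒0; 0⇒≈; triangle)
    renaming (sym to d-sym)

realLine : (R : RealNumbers) → MetricSpace R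
realLine R = record
  { Point           = ℝ
  ; d               = dist
  ; isGeneralMetric = record
    { isSemiMetric = record
      { isQuasiSemiMetric = record
        { isPreMetric = record
          { isProtoMetric = record
            { isPartialOrder  = TotalOrder.isPartialOrder totalOrder
            ; ≈-isEquivalence = isEquivalence
            ; cong            = cong₂ dist
            ; nonNegative     = λ {x} {y} → 0≤∣ x - y ∣
            }
          ; ≈⇒0 = dist-refl
          }
        ; 0⇒≈ = dist≡0⇒≡
        }
      ; sym = dist-sym
      }
    ; triangle = dist-triangle
    }
  }
  where
  open RealNumbers R

  dist : ℝ → ℝ → ℝ
  dist x y = ∣ x - y ∣

  0≤∣_∣ : ∀ x → 0# ≤ ∣ x ∣
  0≤∣ x ∣ with total 0# x
  ... | inj₁ 0≤x = ≤-trans 0≤x (x≤x⊔y x (- x))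
  ... | inj₂ x≤0 = ≤-trans (subst (_≤ - x) -0≡0 (neg-antimono-≤ x≤0)) (x≤y⊔x x (- x))

  dist-refl : ∀ {x y} → x ≡ y → dist x y ≡ 0#
  dist-refl {x} refl = trans (cong ∣_∣ (-‿inverseʳ x)) (trans (cong (0# ⊔_) -0≡0) (⊔-idem 0#))

  dist≡0⇒≡ : ∀ {x y} → dist x y ≡ 0# → x ≡ y
  dist≡0⇒≡ {x} {y} eq = x-y≡0⇒x≡y x y (antisym z≤0 0≤z)
    where
    z : ℝ
    z = x - y

    z≤0 : z ≤ 0#
    z≤0 = subst (z ≤_) eq (x≤x⊔y z (- z))

    0≤z : 0# ≤ z
    0≤z = subst₂ _≤_ -0≡0 (-‿involutive z)
            (neg-antimono-≤ (subst (- z ≤_) eq (x≤y⊔x z (- z))))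

  -[x-y]≡y-x : ∀ x y → - (x - y) ≡ y - x
  -[x-y]≡y-x x y = trans (sym (-‿+-comm x (- y)))
                  (trans (cong (- x +_) (-‿involutive y)) (+-comm (- x) y))

  dist-sym : ∀ x y → dist x y ≡ dist y x
  dist-sym x y = trans (cong₂ _⊔_ (sym (-[x-y]≡y-x y x)) (-[x-y]≡y-x x y))
                       (⊔-comm (- (y - x)) (y - x))

  telescope : ∀ x y z → (x - y) + (y - z) ≡ x - z
  telescope x y z = trans (+-assoc x (- y) (y - z)) (cong (x +_)
    (trans (sym (+-assoc (- y) y (- z)))
    (trans (cong (_+ - z) (-‿inverseˡ y)) (+-identityˡ (- z)))))

  x-z≤ : ∀ x y z → x - z ≤ dist x y + dist y z
  x-z≤ x y z = subst (_≤ dist x y + dist y z) (telescope x y z)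
    (+-mono-≤ (x≤x⊔y (x - y) (- (x - y))) (x≤x⊔y (y - z) (- (y - z))))

  dist-triangle : ∀ x y z → dist x z ≤ dist x y + dist y z
  dist-triangle x y z = ⊔-lub (x-z≤ x y z)
    (subst₂ _≤_ (sym (-[x-y]≡y-x x z))
      (trans (cong₂ _+_ (dist-sym z y) (dist-sym y x)) (+-comm (dist y z) (dist x y)))
      (x-z≤ z y x))

------------------------------------------------------------------------
-- Server problems

module Server {R : RealNumbers} (X : MetricSpace R) where
  open RealNumbers R
  open MetricSpace X

  -- I is the set of servers: Fin k for k servers, ℕ for infinitely many.
  module _ {I : Set} (_≟ᴵ_ : DecidableEquality I) where

    Config : Set
    Config = I → Point

    move : Config → I → Point → Config
    move C i r j = if does (j ≟ᴵ i) then r else C j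

    -- A schedule names, for each request, the server that is moved to it;
    -- by the triangle inequality nothing is gained by moving others too.
    Schedule : List Point → Set
    Schedule σ = Vec I (length σ)

    cost : Config → (σ : List Point) → Schedule σ → ℝ
    cost C []      []      = 0#
    cost C (r ∷ σ) (i ∷ τ) = d (C i) r + cost (move C i r) σ τ

    cost-nonNeg : ∀ C σ τ → 0# ≤ cost C σ τ
    cost-nonNeg C []      []      = ≤-refl
    cost-nonNeg C (r ∷ σ) (i ∷ τ) = subst (_≤ d (C i) r + cost (move C i r) σ τ)
      (+-identityˡ 0#) (+-mono-≤ nonNegative (cost-nonNeg (move C i r) σ τ))

    -- The server to move, given the past requests (most recent first)
    -- and the current request.
    OnlineAlgorithm : Set
    OnlineAlgorithm = List Point → Point → I

    play : OnlineAlgorithm → List Point → (σ : List Point) → Schedule σ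
    play A past []      = []
    play A past (r ∷ σ) = A past r ∷ play A (r ∷ past) σ

    ALG : OnlineAlgorithm → Config → List Point → ℝ
    ALG A C σ = cost C σ (play A [] σ)

    -- The argument i₀ witnesses that there is at least one server, so
    -- that the infimum is over a nonempty set.
    OPT : I → Config → List Point → ℝ
    OPT i₀ C σ = inf (λ v → ∃[ τ ] cost C σ τ ≡ v)
      (cost C σ (replicate (length σ) i₀) , replicate (length σ) i₀ , refl)
      (0# , λ { _ (τ , refl) → cost-nonNeg C σ τ })

  InfiniteServerCompetitive : Point → ℝ → Set
  InfiniteServerCompetitive s ρ =
    ∃[ A ] ∃[ c ] ∀ σ → ALG ℕ._≟_ A (const s) σ ≤ ρ * OPT ℕ._≟_ 0 (const s) σ + c

  -- The initial configurations C₀ (online) and D₀ (offline) are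
  -- arbitrary; the algorithm does not know D₀, and the additive constant
  -- may depend on both.
  HKServerCompetitive : (h : ℕ) .{{_ : NonZero h}} (k : ℕ) → ℝ → Set
  HKServerCompetitive h k ρ =
    (C₀ : Fin k → Point) → ∃[ A ] ((D₀ : Fin h → Point) → ∃[ c ] ∀ σ →
      ALG Fin._≟_ A C₀ σ ≤ ρ * OPT Fin._≟_ (fromℕ< (>-nonZero⁻¹ h)) D₀ σ + c)

{-# OPTIONS --safe #-}

-- The projections to the two half lines split every distance, so both the
-- line problem and its optimal cost split at 0, with h offline servers and m
-- of the k ≥ 2m online servers on either side.
--
-- On a half line, m servers simulate the infinite server algorithm with its
-- source at distance z beyond the end point: the offline servers then cost
-- h z more, while every server used pays z for leaving the source.  When the
-- simulation needs more than m servers, all servers return to the end point,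
-- z becomes (ε/h) T for the current optimal cost T, and the whole history is
-- replayed.  As m ≥ (1 + 1/ε) ρ h, an epoch with z = (ε/h) T₀ that ends at
-- optimal cost T₁ has moved the servers by at most ρ (T₁ - T₀).  Counting the
-- returns, finished epochs cost 2ρT by telescoping; the current one costs at
-- most ρ (T + h z) ≤ (1 + ε) ρ T.
module Submission where

open import Defs
open import Algebra.Bundles using (CommutativeRing)
open import Data.Fin.Base using (Fin; zero; suc; toℕ; fromℕ<; _↑ˡ_; _↑ʳ_; splitAt)
import Data.Fin.Properties as Fin
open import Data.Integer.Base as ℤ using (ℤ)
import Data.Integer.Properties as ℤ
open import Data.List.Base as List using (List; []; _∷_; length; reverse; _ʳ++_)
import Data.List.Properties as List
open import Data.Nat.Base as ℕ using (ℕ; zero; suc; NonZero; >-nonZero⁻¹)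
import Data.Nat.Properties as ℕ
open import Data.Product.Base using (_×_; _,_; ∃-syntax; proj₁; proj₂)
open import Data.Sum.Base using (_⊎_; inj₁; inj₂; [_,_]′)
open import Data.Vec.Base using (Vec; []; _∷_)
open import Data.Vec.Functional using (_++_)
open import Data.Vec.Functional.Properties using (lookup-++ˡ; lookup-++ʳ)
open import Function.Base using (_∘_; const; id)
open import Relation.Binary.Bundles using (TotalOrder)
open import Relation.Binary.Definitions using (DecidableEquality)
open import Relation.Binary.PropositionalEquality
import Relation.Binary.Reasoning.PartialOrder as PartialOrderReasoning
open import Relation.Nullary using (¬_; yes; no; contradiction)
open import Relation.Nullary.Decidable using (toSum)

-- Arithmetic in an ordered field.

module OrderedField (R : RealNumbers) where
  open RealNumbers R
  open CommutativeRing commutativeRing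
    using (commutativeSemiring; ring; *-comm; *-identityʳ; zeroˡ)
  open import Algebra.Properties.Ring ring using (x[y-z]≈xy-xz; -‿distribˡ-*; -‿distribʳ-*)
  open import Algebra.Solver.Ring.NaturalCoefficients.Default commutativeSemiring public
    using (solve; _:+_; _:*_; _:=_; con)

  module ≤-Reasoning = PartialOrderReasoning (TotalOrder.poset totalOrder)

  x+y-y≡x : ∀ x y → (x + y) - y ≡ x
  x+y-y≡x x y = trans (+-assoc x y (- y)) (trans (cong (x +_) (-‿inverseʳ y)) (+-identityʳ x))

  +-cancelʳ-≤ : ∀ z {x y} → x + z ≤ y + z → x ≤ y
  +-cancelʳ-≤ z {x} {y} le = subst₂ _≤_ (x+y-y≡x x z) (x+y-y≡x y z) (+-monoˡ-≤ (- z) le)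

  -- Every linear inequality a ≤ b is derived from some x ≤ y in this form,
  -- so that only a semiring identity remains to be solved.
  ≤-transport : ∀ {x y} → x ≤ y → ∀ {a b} → a + y ≡ b + x → a ≤ b
  ≤-transport {x} {y} x≤y {a} {b} eq =
    +-cancelʳ-≤ y (subst (_≤ b + y) (sym eq) (+-monoʳ-≤ b x≤y))

  x≤y+z⇒x-y≤z : ∀ {x} y {z} → x ≤ y + z → x - y ≤ z
  x≤y+z⇒x-y≤z {x} y {z} le =
    subst (x - y ≤_) (trans (cong (_- y) (+-comm y z)) (x+y-y≡x z y)) (+-monoˡ-≤ (- y) le)

  x-y≤z⇒x≤y+z : ∀ {x} y {z} → x - y ≤ z → x ≤ y + z
  x-y≤z⇒x≤y+z {x} y {z} le = subst (_≤ y + z)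
    (trans (cong (y +_) (+-comm x (- y))) (x+[-x+y]≡y y x)) (+-monoʳ-≤ y le)

  +-nonNeg : ∀ {x y} → 0# ≤ x → 0# ≤ y → 0# ≤ x + y
  +-nonNeg 0≤x 0≤y = subst (_≤ _) (+-identityˡ 0#) (+-mono-≤ 0≤x 0≤y)

  0≤y-x : ∀ {x y} → x ≤ y → 0# ≤ y - x
  0≤y-x {x} {y} x≤y = subst (_≤ y - x) (-‿inverseʳ x) (+-monoˡ-≤ (- x) x≤y)

  *-monoʳ-≤ : ∀ {z} → 0# ≤ z → ∀ {x y} → x ≤ y → z * x ≤ z * y
  *-monoʳ-≤ {z} 0≤z {x} {y} x≤y = +-cancelʳ-≤ (- (z * x)) (subst₂ _≤_
    (sym (-‿inverseʳ (z * x))) (x[y-z]≈xy-xz z y x) (*-nonNeg 0≤z (0≤y-x x≤y)))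

  *-monoˡ-≤ : ∀ {z} → 0# ≤ z → ∀ {x y} → x ≤ y → x * z ≤ y * z
  *-monoˡ-≤ {z} 0≤z {x} {y} x≤y =
    subst₂ _≤_ (*-comm z x) (*-comm z y) (*-monoʳ-≤ 0≤z x≤y)

  0≤-x : ∀ {x} → x ≤ 0# → 0# ≤ - x
  0≤-x x≤0 = subst (_≤ _) -0≡0 (neg-antimono-≤ x≤0)

  0≤1 : 0# ≤ 1#
  0≤1 with total 0# 1#
  ... | inj₁ 0≤1 = 0≤1
  -- Here `- 1#` is nonnegative, hence so is its square `1#`.
  ... | inj₂ 1≤0 = subst (0# ≤_)
    (trans (sym (-‿distribˡ-* 1# (- 1#)))
      (trans (cong -_ (trans (sym (-‿distribʳ-* 1# 1#)) (cong -_ (*-identityʳ 1#))))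
        (-‿involutive 1#)))
    (*-nonNeg (0≤-x 1≤0) (0≤-x 1≤0))

  x≤x+y : ∀ {x y} → 0# ≤ y → x ≤ x + y
  x≤x+y {x} {y} 0≤y = subst (_≤ x + y) (+-identityʳ x) (+-monoʳ-≤ x 0≤y)

  1≰0 : ¬ 1# ≤ 0#
  1≰0 1≤0 = 0≢1 (antisym 0≤1 1≤0)

  0≤fromℕ : ∀ n → 0# ≤ fromℕ n
  0≤fromℕ zero    = ≤-refl
  0≤fromℕ (suc n) = +-nonNeg 0≤1 (0≤fromℕ n)

  fromℕ-mono-≤ : ∀ {m n} → m ℕ.≤ n → fromℕ m ≤ fromℕ n
  fromℕ-mono-≤ {n = n} ℕ.z≤n   = 0≤fromℕ n
  fromℕ-mono-≤ (ℕ.s≤s m≤n)     = +-monoʳ-≤ 1# (fromℕ-mono-≤ m≤n)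

  fromℕ[1+n]≰0 : ∀ n → ¬ fromℕ (suc n) ≤ 0#
  fromℕ[1+n]≰0 n le = 1≰0 (≤-trans (x≤x+y {1#} (0≤fromℕ n)) le)

  fromℤ-nonNeg⁻¹ : ∀ i → 0# ≤ fromℤ i → ∃[ n ] i ≡ ℤ.+ n
  fromℤ-nonNeg⁻¹ (ℤ.+ n)    _  = n , refl
  fromℤ-nonNeg⁻¹ ℤ.-[1+ n ] le = contradiction
    (subst₂ _≤_ (-‿involutive _) -0≡0 (neg-antimono-≤ le)) (fromℕ[1+n]≰0 n)

  y*x≡1⇒0≤y : ∀ {x y} → 0# ≤ x → y * x ≡ 1# → 0# ≤ y
  y*x≡1⇒0≤y {x} {y} 0≤x yx≡1 with total 0# y
  ... | inj₁ 0≤y = 0≤y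
  ... | inj₂ y≤0 = contradiction
    (subst₂ _≤_ yx≡1 (zeroˡ x) (*-monoˡ-≤ 0≤x y≤0)) 1≰0

  IsInf-greatest : ∀ {P v x} → IsInf P v → IsLowerBound P x → x ≤ v
  IsInf-greatest {v = v} {x} (_ , approx) x≤P with total x v
  ... | inj₁ x≤v = x≤v
  ... | inj₂ v≤x with v ≟ x
  ...   | yes v≡x = ≤-reflexive (sym v≡x)
  ...   | no  v≢x with y , Py , y≤x , y≢x ← approx x (v≤x , v≢x) =
    contradiction (antisym y≤x (x≤P y Py)) y≢x

-- Distances on the line and the projections to the half lines.

module Distance (R : RealNumbers) where
  open RealNumbers R
  open OrderedField R
  open MetricSpace (realLine R) using (d; ≈⇒0; d-sym)

  d-refl : ∀ x → d x x ≡ 0#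
  d-refl x = ≈⇒0 refl

  d[x,x+w]≡w : ∀ x {w} → 0# ≤ w → d x (x + w) ≡ w
  d[x,x+w]≡w x {w} 0≤w = antisym
    (⊔-lub (subst (_≤ w) (sym x-[x+w]≡-w) -w≤w) (≤-reflexive -[x-[x+w]]≡w))
    (subst (_≤ d x (x + w)) -[x-[x+w]]≡w (x≤y⊔x _ _))
    where
    x-[x+w]≡-w : x - (x + w) ≡ - w
    x-[x+w]≡-w = trans (cong (x +_) (sym (-‿+-comm x w)))
      (trans (sym (+-assoc x (- x) (- w)))
        (trans (cong (_+ - w) (-‿inverseʳ x)) (+-identityˡ (- w))))

    -[x-[x+w]]≡w : - (x - (x + w)) ≡ w
    -[x-[x+w]]≡w = trans (cong -_ x-[x+w]≡-w) (-‿involutive w)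

    -w≤w : - w ≤ w
    -w≤w = ≤-trans (subst (- w ≤_) -0≡0 (neg-antimono-≤ 0≤w)) 0≤w

  x≤y⇒x+d≡y : ∀ {x y} → x ≤ y → x + d x y ≡ y
  x≤y⇒x+d≡y {x} {y} x≤y = trans (cong (λ v → x + d x v) (sym x+[y-x]≡y))
    (trans (cong (x +_) (d[x,x+w]≡w x (0≤y-x x≤y))) x+[y-x]≡y)
    where
    x+[y-x]≡y : x + (y - x) ≡ y
    x+[y-x]≡y = trans (cong (x +_) (+-comm y (- x))) (x+[-x+y]≡y x y)

  d-translate : ∀ t x y → d (t + x) (t + y) ≡ d x y
  d-translate t x y = cong ∣_∣ (begin
    (t + x) - (t + y)         ≡⟨ cong ((t + x) +_) (sym (-‿+-comm t y)) ⟩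
    (t + x) + (- t + - y)     ≡⟨ solve 4 (λ t x t' y' →
                                   (t :+ x) :+ (t' :+ y') := (x :+ y') :+ (t :+ t'))
                                   refl t x (- t) (- y) ⟩
    (x - y) + (t - t)         ≡⟨ cong ((x - y) +_) (-‿inverseʳ t) ⟩
    (x - y) + 0#              ≡⟨ +-identityʳ (x - y) ⟩
    x - y                     ∎)
    where open ≡-Reasoning

  d-neg : ∀ x y → d (- x) (- y) ≡ d x y
  d-neg x y = trans (cong ∣_∣ (trans (cong (- x +_) (-‿involutive y)) (+-comm (- x) y)))
                    (d-sym y x)

  positivePart negativePart : ℝ → ℝ
  positivePart x = x ⊔ 0#
  negativePart x = (- x) ⊔ 0#

  0≤positivePart : ∀ x → 0# ≤ positivePart x
  0≤positivePart x = x≤y⊔x x 0#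

  0≤negativePart : ∀ x → 0# ≤ negativePart x
  0≤negativePart x = x≤y⊔x (- x) 0#

  x≤y⇒x⊔z≤y⊔z : ∀ z {x y} → x ≤ y → x ⊔ z ≤ y ⊔ z
  x≤y⇒x⊔z≤y⊔z z x≤y = ⊔-lub (≤-trans x≤y (x≤x⊔y _ _)) (x≤y⊔x _ _)

  0≤x⇒x⊔0≡x : ∀ {x} → 0# ≤ x → x ⊔ 0# ≡ x
  0≤x⇒x⊔0≡x 0≤x = antisym (⊔-lub ≤-refl 0≤x) (x≤x⊔y _ _)

  x≤0⇒x⊔0≡0 : ∀ {x} → x ≤ 0# → x ⊔ 0# ≡ 0#
  x≤0⇒x⊔0≡0 x≤0 = antisym (⊔-lub x≤0 ≤-refl) (x≤y⊔x _ _)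

  positivePart≡x+negativePart : ∀ x → positivePart x ≡ x + negativePart x
  positivePart≡x+negativePart x = [ nonNeg , nonPos ]′ (total 0# x)
    where
    open ≡-Reasoning

    nonNeg : 0# ≤ x → positivePart x ≡ x + negativePart x
    nonNeg 0≤x = begin
      x ⊔ 0#            ≡⟨ 0≤x⇒x⊔0≡x 0≤x ⟩
      x                 ≡⟨ +-identityʳ x ⟨
      x + 0#            ≡⟨ cong (x +_) (x≤0⇒x⊔0≡0 (subst (- x ≤_) -0≡0 (neg-antimono-≤ 0≤x))) ⟨
      x + ((- x) ⊔ 0#)  ∎

    nonPos : x ≤ 0# → positivePart x ≡ x + negativePart x
    nonPos x≤0 = begin
      x ⊔ 0#            ≡⟨ x≤0⇒x⊔0≡0 x≤0 ⟩
      0#                ≡⟨ -‿inverseʳ x ⟨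
      x + (- x)         ≡⟨ cong (x +_) (0≤x⇒x⊔0≡x (0≤-x x≤0)) ⟨
      x + ((- x) ⊔ 0#)  ∎

  -- One part is monotone and the other antitone, so the two distances are `y⁺ - x⁺` and `x⁻ - y⁻`;
  -- with `x = x⁺ - x⁻` they add up to `y - x`. Adding `x⁺ + y⁻` on both sides avoids subtraction.
  d-parts-≤ : ∀ {x y} → x ≤ y →
    d (positivePart x) (positivePart y) + d (negativePart x) (negativePart y) ≡ d x y
  d-parts-≤ {x} {y} x≤y = +-cancelʳ (x⁺ + y⁻) _ _ (begin
    (d⁺ + d⁻) + (x⁺ + y⁻)  ≡⟨ solve 4 (λ a b c d → (a :+ b) :+ (c :+ d) := (c :+ a) :+ (d :+ b))
                                refl d⁺ d⁻ x⁺ y⁻ ⟩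
    (x⁺ + d⁺) + (y⁻ + d⁻)  ≡⟨ cong₂ _+_ (x≤y⇒x+d≡y (x≤y⇒x⊔z≤y⊔z 0# x≤y))
                                (trans (cong (y⁻ +_) (d-sym x⁻ y⁻))
                                  (x≤y⇒x+d≡y (x≤y⇒x⊔z≤y⊔z 0# (neg-antimono-≤ x≤y)))) ⟩
    positivePart y + x⁻    ≡⟨ cong (_+ x⁻) (positivePart≡x+negativePart y) ⟩
    (y + y⁻) + x⁻          ≡⟨ cong (λ v → (v + y⁻) + x⁻) (x≤y⇒x+d≡y x≤y) ⟨
    ((x + d x y) + y⁻) + x⁻ ≡⟨ solve 4 (λ a b c d → ((a :+ b) :+ c) :+ d := b :+ ((a :+ d) :+ c))
                                refl x (d x y) y⁻ x⁻ ⟩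
    d x y + ((x + x⁻) + y⁻) ≡⟨ cong (λ v → d x y + (v + y⁻)) (positivePart≡x+negativePart x) ⟨
    d x y + (x⁺ + y⁻)      ∎)
    where
    open ≡-Reasoning
    open import Algebra.Properties.AbelianGroup +-abelianGroup
      using () renaming (∙-cancelʳ to +-cancelʳ)

    x⁺ x⁻ y⁻ d⁺ d⁻ : ℝ
    x⁺ = positivePart x
    x⁻ = negativePart x
    y⁻ = negativePart y
    d⁺ = d x⁺ (positivePart y)
    d⁻ = d x⁻ y⁻

  d-parts : ∀ x y →
    d (positivePart x) (positivePart y) + d (negativePart x) (negativePart y) ≡ d x y
  d-parts x y = [ d-parts-≤ , reversed ]′ (total x y)
    where
    reversed : y ≤ x →
      d (positivePart x) (positivePart y) + d (negativePart x) (negativePart y) ≡ d x y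
    reversed y≤x = trans
      (cong₂ _+_ (d-sym (positivePart x) (positivePart y)) (d-sym (negativePart x) (negativePart y)))
      (trans (d-parts-≤ y≤x) (d-sym y x))

-- The ℓ¹ distance between configurations.

module L¹ (R : RealNumbers) where
  open RealNumbers R
  open OrderedField R
  open Distance R
  open MetricSpace (realLine R) using (d; nonNegative; d-sym; triangle)
  open Server (realLine R) using (move)
  open CommutativeRing commutativeRing using (zeroˡ)

  D : ∀ {n} → (Fin n → ℝ) → (Fin n → ℝ) → ℝ
  D {zero}  u v = 0#
  D {suc n} u v = d (u zero) (v zero) + D (u ∘ suc) (v ∘ suc)

  D-nonNeg : ∀ {n} (u v : Fin n → ℝ) → 0# ≤ D u v
  D-nonNeg {zero}  u v = ≤-refl
  D-nonNeg {suc n} u v = +-nonNeg nonNegative (D-nonNeg (u ∘ suc) (v ∘ suc))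

  D-cong : ∀ {n} {u u′ v v′ : Fin n → ℝ} → u ≗ u′ → v ≗ v′ → D u v ≡ D u′ v′
  D-cong {zero}  u≗u′ v≗v′ = refl
  D-cong {suc n} u≗u′ v≗v′ =
    cong₂ _+_ (cong₂ d (u≗u′ zero) (v≗v′ zero)) (D-cong (u≗u′ ∘ suc) (v≗v′ ∘ suc))

  D-refl : ∀ {n} (u : Fin n → ℝ) → D u u ≡ 0#
  D-refl {zero}  u = refl
  D-refl {suc n} u = trans (cong₂ _+_ (d-refl (u zero)) (D-refl (u ∘ suc))) (+-identityˡ 0#)

  D-sym : ∀ {n} (u v : Fin n → ℝ) → D u v ≡ D v u
  D-sym {zero}  u v = refl
  D-sym {suc n} u v = cong₂ _+_ (d-sym (u zero) (v zero)) (D-sym (u ∘ suc) (v ∘ suc))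

  D-triangle : ∀ {n} (u v w : Fin n → ℝ) → D u w ≤ D u v + D v w
  D-triangle {zero}  u v w = ≤-reflexive (sym (+-identityˡ 0#))
  D-triangle {suc n} u v w = subst (D u w ≤_)
    (solve 4 (λ a b c e → (a :+ b) :+ (c :+ e) := (a :+ c) :+ (b :+ e)) refl
      (d (u zero) (v zero)) (d (v zero) (w zero))
      (D (u ∘ suc) (v ∘ suc)) (D (v ∘ suc) (w ∘ suc)))
    (+-mono-≤ (triangle (u zero) (v zero) (w zero)) (D-triangle (u ∘ suc) (v ∘ suc) (w ∘ suc)))

  D-map : ∀ {n} {f : ℝ → ℝ} → (∀ x y → d (f x) (f y) ≡ d x y) →
    (u v : Fin n → ℝ) → D (f ∘ u) (f ∘ v) ≡ D u v
  D-map {zero}  iso u v = refl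
  D-map {suc n} iso u v = cong₂ _+_ (iso (u zero) (v zero)) (D-map iso (u ∘ suc) (v ∘ suc))

  D-const : ∀ n x {w} → 0# ≤ w → D {n} (const x) (const (x + w)) ≡ fromℕ n * w
  D-const zero    x {w} 0≤w = sym (zeroˡ w)
  D-const (suc n) x {w} 0≤w = trans (cong₂ _+_ (d[x,x+w]≡w x 0≤w) (D-const n x 0≤w))
    (solve 2 (λ w n → w :+ n :* w := (con 1 :+ n) :* w) refl w (fromℕ n))

  D-++ : ∀ {m n} (u u′ : Fin m → ℝ) (v v′ : Fin n → ℝ) →
    D (u ++ v) (u′ ++ v′) ≡ D u u′ + D v v′
  D-++ {zero}  u u′ v v′ = sym (+-identityˡ _)
  D-++ {suc m} u u′ v v′ = trans
    (cong (d (u zero) (u′ zero) +_) (trans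
      (D-cong (suc-++ u v) (suc-++ u′ v′)) (D-++ (u ∘ suc) (u′ ∘ suc) v v′)))
    (sym (+-assoc _ _ _))
    where
    suc-++ : ∀ {n} (u : Fin (suc m) → ℝ) (v : Fin n → ℝ) → (u ++ v) ∘ suc ≗ (u ∘ suc) ++ v
    suc-++ u v i with splitAt m i
    ... | inj₁ _ = refl
    ... | inj₂ _ = refl

  move-self : ∀ {I : Set} (_≟ᴵ_ : DecidableEquality I) (C : I → ℝ) i r →
    move _≟ᴵ_ C i r i ≡ r
  move-self _≟ᴵ_ C i r with i ≟ᴵ i
  ... | yes _   = refl
  ... | no  i≢i = contradiction refl i≢i

  move-other : ∀ {I : Set} (_≟ᴵ_ : DecidableEquality I) (C : I → ℝ) {i j} r → j ≢ i →
    move _≟ᴵ_ C i r j ≡ C j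
  move-other _≟ᴵ_ C {i} {j} r j≢i with j ≟ᴵ i
  ... | yes j≡i = contradiction j≡i j≢i
  ... | no  _   = refl

  -- A server that jumps to its own target gives up exactly its summand of the distance, which pays
  -- for the jump.
  D-move : ∀ {n} (C V : Fin n → ℝ) i →
    d (C i) (V i) + D (move Fin._≟_ C i (V i)) V ≡ D C V
  D-move C V zero = cong (d (C zero) (V zero) +_)
    (trans (cong (_+ D (C ∘ suc) (V ∘ suc)) (d-refl (V zero))) (+-identityˡ _))
  D-move C V (suc i) = trans
    (solve 3 (λ a b c → a :+ (b :+ c) := b :+ (a :+ c)) refl
      (d (C (suc i)) (V (suc i))) (d (C zero) (V zero)) _)
    (cong (d (C zero) (V zero) +_) (D-move (C ∘ suc) (V ∘ suc) i))

-- Costs along histories, and servers that chase virtual configurations.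

module Histories (R : RealNumbers) where
  open RealNumbers R
  open OrderedField R
  open Distance R
  open L¹ R
  open MetricSpace (realLine R) using (d; nonNegative)
  open Server (realLine R)

  -- A history lists the requests with the most recent one first; the
  -- request r is replaced by the point g r.
  module _ {I : Set} (_≟ᴵ_ : DecidableEquality I) (g : ℝ → ℝ) (C : I → ℝ)
           (a : List ℝ → ℝ → I) where

    configAfter : List ℝ → I → ℝ
    configAfter []      = C
    configAfter (r ∷ p) = move _≟ᴵ_ (configAfter p) (a p r) (g r)

    costAfter : List ℝ → ℝ
    costAfter []      = 0#
    costAfter (r ∷ p) = costAfter p + d (configAfter p (a p r)) (g r)

  module _ {I : Set} (_≟ᴵ_ : DecidableEquality I) where

    costAfter-mono : ∀ g C a r p → costAfter _≟ᴵ_ g C a p ≤ costAfter _≟ᴵ_ g C a (r ∷ p)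
    costAfter-mono g C a r p = x≤x+y nonNegative

    costAfter-nonNeg : ∀ g C a p → 0# ≤ costAfter _≟ᴵ_ g C a p
    costAfter-nonNeg g C a []      = ≤-refl
    costAfter-nonNeg g C a (r ∷ p) =
      ≤-trans (costAfter-nonNeg g C a p) (costAfter-mono g C a r p)

    -- The past `p` is arbitrary because the induction on `σ` pushes requests onto it, which also
    -- reverses their order.
    cost-play : ∀ C a p σ →
      costAfter _≟ᴵ_ id C a p + cost _≟ᴵ_ (configAfter _≟ᴵ_ id C a p) σ (play _≟ᴵ_ a p σ)
        ≡ costAfter _≟ᴵ_ id C a (σ ʳ++ p)
    cost-play C a p []      = +-identityʳ _
    cost-play C a p (r ∷ σ) = trans (sym (+-assoc _ _ _)) (cost-play C a (r ∷ p) σ)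

    ALG≡costAfter : ∀ a C σ → ALG _≟ᴵ_ a C σ ≡ costAfter _≟ᴵ_ id C a (reverse σ)
    ALG≡costAfter a C σ = trans (sym (+-identityˡ _)) (cost-play C a [] σ)

    module _ (g : ℝ → ℝ) (C : I → ℝ) {a a′ : List ℝ → ℝ → I}
             (a′≡a : ∀ p r → a′ (List.map g p) (g r) ≡ a p r) where

      configAfter-map : ∀ p i →
        configAfter _≟ᴵ_ id C a′ (List.map g p) i ≡ configAfter _≟ᴵ_ g C a p i
      configAfter-map []      i = refl
      configAfter-map (r ∷ p) i rewrite a′≡a p r with i ≟ᴵ a p r
      ... | yes _ = refl
      ... | no  _ = configAfter-map p i

      -- Exchanges an algorithm that sees transformed requests for one that sees the original
      -- history, so that later bounds can all speak about one history.
      costAfter-map : ∀ p → costAfter _≟ᴵ_ id C a′ (List.map g p) ≡ costAfter _≟ᴵ_ g C a p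
      costAfter-map []      = refl
      costAfter-map (r ∷ p) rewrite a′≡a p r =
        cong₂ _+_ (costAfter-map p) (cong (λ x → d x (g r)) (configAfter-map p (a p r)))

    configAfter-image : ∀ (f : ℝ → ℝ) (C : I → ℝ) a p i →
      configAfter _≟ᴵ_ f (f ∘ C) a p i ≡ f (configAfter _≟ᴵ_ id C a p i)
    configAfter-image f C a []      i = refl
    configAfter-image f C a (r ∷ p) i with i ≟ᴵ a p r
    ... | yes _ = refl
    ... | no  _ = configAfter-image f C a p i

    -- The same decisions are played on both half lines, where every server stays at the projection
    -- of its position on the line; `d-parts` then splits each single move.
    costAfter-parts : ∀ (C : I → ℝ) a p →
      costAfter _≟ᴵ_ positivePart (positivePart ∘ C) a p
        + costAfter _≟ᴵ_ negativePart (negativePart ∘ C) a p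
        ≡ costAfter _≟ᴵ_ id C a p
    costAfter-parts C a []      = +-identityˡ 0#
    costAfter-parts C a (r ∷ p)
      rewrite configAfter-image positivePart C a p (a p r)
            | configAfter-image negativePart C a p (a p r) = trans
      (solve 4 (λ a b c e → (a :+ b) :+ (c :+ e) := (a :+ c) :+ (b :+ e)) refl
        (costAfter _≟ᴵ_ positivePart (positivePart ∘ C) a p)
        (d (positivePart x) (positivePart r))
        (costAfter _≟ᴵ_ negativePart (negativePart ∘ C) a p)
        (d (negativePart x) (negativePart r)))
      (cong₂ _+_ (costAfter-parts C a p) (d-parts x r))
      where
      x : ℝ
      x = configAfter _≟ᴵ_ id C a p (a p r)

  module _ {n : ℕ} (g : ℝ → ℝ) (C : ℝ) (a : List ℝ → ℝ → Fin n) where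

    private
      F : List ℝ → ℕ → ℝ
      F = configAfter ℕ._≟_ g (const C) (λ p r → toℕ (a p r))

    configAfter-toℕ : ∀ p j →
      F p (toℕ j)
        ≡ configAfter Fin._≟_ g (const C) a p j
    configAfter-toℕ []      j = refl
    configAfter-toℕ (r ∷ p) j with j Fin.≟ a p r
    ... | yes refl = move-self ℕ._≟_ (F p) (toℕ j) (g r)
    ... | no  j≢i  = trans
      (move-other ℕ._≟_ (F p) (g r) (j≢i ∘ Fin.toℕ-injective)) (configAfter-toℕ p j)

    -- Finitely many servers act as the first of infinitely many, the rest of which never move. This
    -- makes an offline strategy with `h` servers one for the infinite server problem.
    costAfter-toℕ : ∀ p →
      costAfter ℕ._≟_ g (const C) (λ p r → toℕ (a p r)) p
        ≡ costAfter Fin._≟_ g (const C) a p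
    costAfter-toℕ []      = refl
    costAfter-toℕ (r ∷ p) =
      cong₂ _+_ (costAfter-toℕ p) (cong (λ x → d x (g r)) (configAfter-toℕ p (a p r)))

  travel : ∀ {n} → (List ℝ → Fin n → ℝ) → List ℝ → ℝ
  travel V []      = 0#
  travel V (r ∷ p) = travel V p + D (V p) (V (r ∷ p))

  travel-mono : ∀ {n} (V : List ℝ → Fin n → ℝ) r p → travel V p ≤ travel V (r ∷ p)
  travel-mono V r p = x≤x+y (D-nonNeg (V p) (V (r ∷ p)))

  -- Used to bound the cost of returning all servers to where they started.
  D≤travel : ∀ {n} (V : List ℝ → Fin n → ℝ) p → D (V []) (V p) ≤ travel V p
  D≤travel V []      = ≤-reflexive (D-refl (V []))
  D≤travel V (r ∷ p) = ≤-trans (D-triangle (V []) (V p) (V (r ∷ p)))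
    (+-monoˡ-≤ _ (D≤travel V p))

  -- Servers that merely chase the virtual configurations V are kept on
  -- budget by the potential D.
  lazy : ∀ {n} g (C : Fin n → ℝ) a (V : List ℝ → Fin n → ℝ) →
    (∀ p r → V (r ∷ p) (a p r) ≡ g r) → ∀ p →
    costAfter Fin._≟_ g C a p + D (configAfter Fin._≟_ g C a p) (V p) ≤ D C (V []) + travel V p
  lazy g C a V hits [] = ≤-reflexive (+-comm _ _)
  lazy g C a V hits (r ∷ p) = ≤-transport (+-mono-≤ (lazy g C a V hits p) step)
    (solve 7 (λ c x y t s e b →
      ((c :+ x) :+ y) :+ ((b :+ t) :+ (e :+ s)) := (b :+ (t :+ s)) :+ ((c :+ e) :+ (x :+ y)))
      refl (costAfter Fin._≟_ g C a p) (d (F (a p r)) (g r))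
      (D (configAfter Fin._≟_ g C a (r ∷ p)) (V (r ∷ p)))
      (travel V p) (D (V p) (V (r ∷ p))) (D F (V p)) (D C (V [])))
    where
    F : Fin _ → ℝ
    F = configAfter Fin._≟_ g C a p

    step : d (F (a p r)) (g r) + D (configAfter Fin._≟_ g C a (r ∷ p)) (V (r ∷ p))
             ≤ D F (V p) + D (V p) (V (r ∷ p))
    -- The virtual servers move first, raising the potential by at most their movement; the chosen
    -- server then has its target at `g r` and pays by `D-move`.
    step = subst (_≤ D F (V p) + D (V p) (V (r ∷ p)))
      (trans (sym (D-move F (V (r ∷ p)) (a p r)))
        (cong (λ x → d (F (a p r)) x + D (move Fin._≟_ F (a p r) x) (V (r ∷ p))) (hits p r)))
      (D-triangle F (V p) (V (r ∷ p)))

  lazy-cost : ∀ {n} g (C : Fin n → ℝ) a (V : List ℝ → Fin n → ℝ) →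
    (∀ p r → V (r ∷ p) (a p r) ≡ g r) → ∀ p →
    costAfter Fin._≟_ g C a p ≤ D C (V []) + travel V p
  lazy-cost g C a V hits p = ≤-trans
    (x≤x+y (D-nonNeg (configAfter Fin._≟_ g C a p) (V p))) (lazy g C a V hits p)

  -- An actual run moves one server per request, so it can itself serve as the virtual motion in
  -- `lazy-cost`.
  travel-configAfter : ∀ {n} g (C : Fin n → ℝ) a p →
    travel (configAfter Fin._≟_ g C a) p ≡ costAfter Fin._≟_ g C a p
  travel-configAfter g C a []      = refl
  travel-configAfter g C a (r ∷ p) = cong₂ _+_ (travel-configAfter g C a p) (begin
    D F F′                             ≡⟨ sym (D-move F F′ i) ⟩
    d (F i) (F′ i) + D (move Fin._≟_ F i (F′ i)) F′
      ≡⟨ cong (λ x → d (F i) x + D (move Fin._≟_ F i x) F′) (move-self Fin._≟_ F i (g r)) ⟩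
    d (F i) (g r) + D F′ F′            ≡⟨ cong (d (F i) (g r) +_) (D-refl F′) ⟩
    d (F i) (g r) + 0#                 ≡⟨ +-identityʳ _ ⟩
    d (F i) (g r)                      ∎)
    where
    open ≡-Reasoning
    i : Fin _
    i = a p r
    F F′ : Fin _ → ℝ
    F = configAfter Fin._≟_ g C a p
    F′ = configAfter Fin._≟_ g C a (r ∷ p)

  -- The servers chase the translated run; only the mismatch of the starting positions costs extra.
  costAfter-translate : ∀ {n} f t (C C′ : Fin n → ℝ) a p →
    costAfter Fin._≟_ (λ r → t + f r) C a p
      ≤ D C (λ i → t + C′ i) + costAfter Fin._≟_ f C′ a p
  costAfter-translate f t C C′ a p = ≤-trans
    (lazy-cost _ C a (λ p i → t + F p i)
      (λ p r → cong (t +_) (move-self Fin._≟_ (F p) (a p r) (f r))) p)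
    (≤-reflexive (cong (D C _ +_) (trans (travel-translate p) (travel-configAfter f C′ a p))))
    where
    F : List ℝ → Fin _ → ℝ
    F = configAfter Fin._≟_ f C′ a

    travel-translate : ∀ p → travel (λ p i → t + F p i) p ≡ travel F p
    travel-translate []      = refl
    travel-translate (r ∷ p) =
      cong₂ _+_ (travel-translate p) (D-map (d-translate t) (F p) (F (r ∷ p)))

-- Optimal offline costs on the line and on the half lines.

module Offline (R : RealNumbers) where
  open RealNumbers R
  open OrderedField R
  open Distance R
  open L¹ R
  open Histories R
  open Server (realLine R)

  -- The infimum in the definition of OPT unfolds to a negated supremum,
  -- the only form in which unification recovers its implicit arguments.
  sup⇒inf : ∀ {P s} → IsSup (λ x → P (- x)) s → IsInf P (- s)
  sup⇒inf {P} {s} (upper , approx) =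
      (λ x Px → subst (- s ≤_) (-‿involutive x)
        (neg-antimono-≤ (upper (- x) (subst P (sym (-‿involutive x)) Px))))
    , (λ y -s<y → let x , P[-x] , -y<x = approx (- y)
                                  (subst (- y <_) (-‿involutive s) (neg-antimono-< -s<y))
                  in - x , P[-x] , subst (- x <_) (-‿involutive y) (neg-antimono-< -y<x))

  module _ {I : Set} (_≟ᴵ_ : DecidableEquality I) (i₀ : I) (C : I → ℝ) (σ : List ℝ) where

    OPT-isInf : IsInf (λ v → ∃[ τ ] cost _≟ᴵ_ C σ τ ≡ v) (OPT _≟ᴵ_ i₀ C σ)
    OPT-isInf = sup⇒inf (proj₂ (complete (λ v → ∃[ τ ] cost _≟ᴵ_ C σ τ ≡ - v) _ _))

    OPT-≤ALG : ∀ a → OPT _≟ᴵ_ i₀ C σ ≤ ALG _≟ᴵ_ a C σ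
    OPT-≤ALG a = proj₁ OPT-isInf _ (play _≟ᴵ_ a [] σ , refl)

    OPT-nonNeg : 0# ≤ OPT _≟ᴵ_ i₀ C σ
    OPT-nonNeg = IsInf-greatest OPT-isInf λ { _ (τ , refl) → cost-nonNeg _≟ᴵ_ C σ τ }

  IsCompetitive : (s ρ : ℝ) → OnlineAlgorithm ℕ._≟_ → ℝ → Set
  IsCompetitive s ρ A c =
    ∀ σ → ALG ℕ._≟_ A (const s) σ ≤ ρ * OPT ℕ._≟_ 0 (const s) σ + c

  -- An offline schedule, disguised as an online algorithm that looks only at the time.
  timed : {I : Set} → (ℕ → I) → List ℝ → ℝ → I
  timed B p _ = B (length p)

  module _ (h : ℕ) .{{_ : NonZero h}} where

    i₀ : Fin h
    i₀ = fromℕ< (>-nonZero⁻¹ h)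

    -- Schedules are infinite, so that one for a longer history also applies to the shorter one, as
    -- `opt-mono` needs.
    Attainable : (ℝ → ℝ) → List ℝ → ℝ → Set
    Attainable f p v = ∃[ B ] costAfter {I = Fin h} Fin._≟_ f (const 0#) (timed B) p ≡ v

    opt : (ℝ → ℝ) → List ℝ → ℝ
    opt f p = inf (Attainable f p) (_ , const i₀ , refl)
      (0# , λ { _ (B , refl) → costAfter-nonNeg Fin._≟_ f (const 0#) (timed B) p })

    opt-isInf : ∀ f p → IsInf (Attainable f p) (opt f p)
    opt-isInf f p = sup⇒inf (proj₂ (complete (λ v → Attainable f p (- v)) _ _))

    opt-≤ : ∀ f p B → opt f p ≤ costAfter Fin._≟_ f (const 0#) (timed B) p
    opt-≤ f p B = proj₁ (opt-isInf f p) _ (B , refl)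

    opt-greatest : ∀ f p {x} →
      (∀ B → x ≤ costAfter Fin._≟_ f (const 0#) (timed B) p) → x ≤ opt f p
    opt-greatest f p x≤ = IsInf-greatest (opt-isInf f p) λ { _ (B , refl) → x≤ B }

    opt-nonNeg : ∀ f p → 0# ≤ opt f p
    opt-nonNeg f p = opt-greatest f p (λ B → costAfter-nonNeg Fin._≟_ f (const 0#) (timed B) p)

    opt-mono : ∀ f r p → opt f p ≤ opt f (r ∷ p)
    opt-mono f r p = opt-greatest f (r ∷ p) λ B →
      ≤-trans (opt-≤ f p B) (costAfter-mono Fin._≟_ f (const 0#) (timed B) r p)

    nth : ∀ {n} → Vec (Fin h) n → ℕ → Fin h
    nth []      t       = i₀
    nth (i ∷ τ) zero    = i
    nth (i ∷ τ) (suc t) = nth τ t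

    play-timed : ∀ B p σ τ → (∀ t → B (t ℕ.+ length p) ≡ nth τ t) →
      play Fin._≟_ (timed B) p σ ≡ τ
    play-timed B p []      []      eq = refl
    play-timed B p (r ∷ σ) (i ∷ τ) eq = cong₂ _∷_ (eq 0)
      (play-timed B (r ∷ p) σ τ (λ t → trans (cong B (ℕ.+-suc t (length p))) (eq (suc t))))

    cost≡costAfter : ∀ C σ τ →
      cost Fin._≟_ C σ τ ≡ costAfter Fin._≟_ id C (timed (nth τ)) (reverse σ)
    cost≡costAfter C σ τ = trans
      (cong (cost Fin._≟_ C σ)
        (sym (play-timed (nth τ) [] σ τ (λ t → cong (nth τ) (ℕ.+-identityʳ t)))))
      (ALG≡costAfter Fin._≟_ (timed (nth τ)) C σ)

    -- A schedule for the line is at once a schedule for both half lines, with costs that add up.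
    -- Starting at 0 instead of `C` costs at most the initial distance, by chasing the run from `C`.
    opt-parts : ∀ C σ →
      opt positivePart (reverse σ) + opt negativePart (reverse σ)
        ≤ D (const 0#) C + OPT Fin._≟_ i₀ C σ
    opt-parts C σ = x-y≤z⇒x≤y+z (D (const 0#) C)
      (IsInf-greatest (OPT-isInf Fin._≟_ i₀ C σ) λ { _ (τ , refl) → bound τ })
      where
      p : List ℝ
      p = reverse σ

      o : ℝ
      o = opt positivePart p + opt negativePart p

      bound : ∀ τ → o - D (const 0#) C ≤ cost Fin._≟_ C σ τ
      bound τ = x≤y+z⇒x-y≤z (D (const 0#) C) total-bound
        where
        a : List ℝ → ℝ → Fin h
        a = timed (nth τ)

        opt-≤′ : ∀ f → f 0# ≡ 0# → opt f p ≤ costAfter Fin._≟_ f (const (f 0#)) a p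
        opt-≤′ f f0≡0 = subst (λ x → opt f p ≤ costAfter Fin._≟_ f (const x) a p)
          (sym f0≡0) (opt-≤ f p (nth τ))

        total-bound : o ≤ D (const 0#) C + cost Fin._≟_ C σ τ
        total-bound = ≤-trans
          (+-mono-≤ (opt-≤′ positivePart (⊔-idem 0#))
                    (opt-≤′ negativePart (trans (cong (_⊔ 0#) -0≡0) (⊔-idem 0#))))
          (subst₂ _≤_ (sym (costAfter-parts Fin._≟_ (const 0#) a p))
            (cong (D (const 0#) C +_)
              (trans (travel-configAfter id C a p) (sym (cost≡costAfter C σ τ))))
            (lazy-cost id (const 0#) a (configAfter Fin._≟_ id C a)
              (λ p r → move-self Fin._≟_ (configAfter Fin._≟_ id C a p) (a p r) r) p))

-- Simulating the infinite server algorithm on a half line.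

module Simulation (R : RealNumbers) (s ρ : RealNumbers.ℝ R)
  (A : Server.OnlineAlgorithm (realLine R) ℕ._≟_) (c : RealNumbers.ℝ R)
  (A-competitive : Offline.IsCompetitive R s ρ A c)
  where
  open RealNumbers R
  open OrderedField R
  open Distance R
  open L¹ R
  open Histories R
  open Offline R
  open MetricSpace (realLine R) using (d; nonNegative)
  open Server (realLine R)
  open CommutativeRing commutativeRing using (zeroˡ; zeroʳ; *-assoc)

  -- Nonnegative and strictly above `c`; the strictness gives the contradictions in `0≤ρ` and
  -- `restart-fits`.
  c⁺ : ℝ
  c⁺ = (c ⊔ 0#) + 1#

  0≤c⁺ : 0# ≤ c⁺
  0≤c⁺ = +-nonNeg (x≤y⊔x c 0#) 0≤1

  c≤c⁺ : c ≤ c⁺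
  c≤c⁺ = ≤-trans (x≤x⊔y c 0#) (x≤x+y 0≤1)

  c⁺≰c : ¬ c⁺ ≤ c
  c⁺≰c le = 1≰0 (≤-transport (+-mono-≤ le (x≤x⊔y c 0#))
    (solve 2 (λ m c → con 1 :+ (c :+ m) := con 0 :+ ((m :+ con 1) :+ c)) refl (c ⊔ 0#) c))

  -- Otherwise `A` would never pay more than `c`, yet a single request at distance `c⁺` from the
  -- source costs `c⁺`.
  0≤ρ : 0# ≤ ρ
  0≤ρ with total 0# ρ
  ... | inj₁ 0≤ρ = 0≤ρ
  ... | inj₂ ρ≤0 = contradiction c⁺≤c c⁺≰c
    where
    σ : List ℝ
    σ = s + c⁺ ∷ []

    c⁺≤c : c⁺ ≤ c
    c⁺≤c = subst₂ _≤_ (trans (+-identityʳ _) (d[x,x+w]≡w s 0≤c⁺)) (+-identityˡ c)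
      (≤-trans (A-competitive σ) (+-monoˡ-≤ c
        (subst (ρ * OPT ℕ._≟_ 0 (const s) σ ≤_) (zeroˡ _)
          (*-monoˡ-≤ (OPT-nonNeg ℕ._≟_ 0 (const s) σ) ρ≤0))))

  -- The end point 0 of the half line is placed at s + z, and the source s at
  -- distance z beyond it.
  module _ (f : ℝ → ℝ) (z : ℝ) where

    shifted : ℝ → ℝ
    shifted r = (s + z) + f r

    decisions : List ℝ → ℝ → ℕ
    decisions p r = A (List.map shifted p) (shifted r)

    simCost : List ℝ → ℝ
    simCost = costAfter ℕ._≟_ shifted (const s) decisions

    module _ (h : ℕ) .{{_ : NonZero h}} (0≤z : 0# ≤ z) (p : List ℝ) where

      private
        σ : List ℝ
        σ = reverse (List.map shifted p)

      -- Each of the `h` offline servers pays `z` to get from the source to the end point, and then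
      -- follows the half line schedule.
      OPT-≤opt : OPT ℕ._≟_ 0 (const s) σ ≤ fromℕ h * z + opt h f p
      OPT-≤opt = x-y≤z⇒x≤y+z (fromℕ h * z)
        (opt-greatest h f p λ B → x≤y+z⇒x-y≤z (fromℕ h * z) (bound B))
        where
        bound : ∀ B → OPT ℕ._≟_ 0 (const s) σ
          ≤ fromℕ h * z + costAfter Fin._≟_ f (const 0#) (timed B) p
        bound B = begin
          OPT ℕ._≟_ 0 (const s) σ
            ≤⟨ OPT-≤ALG ℕ._≟_ 0 (const s) σ a ⟩
          ALG ℕ._≟_ a (const s) σ
            ≡⟨ ALG≡costAfter ℕ._≟_ a (const s) σ ⟩
          costAfter ℕ._≟_ id (const s) a (reverse σ)
            ≡⟨ cong (costAfter ℕ._≟_ id (const s) a) (List.reverse-involutive (List.map shifted p)) ⟩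
          costAfter ℕ._≟_ id (const s) a (List.map shifted p)
            ≡⟨ costAfter-map ℕ._≟_ shifted (const s)
                 (λ p r → cong (toℕ ∘ B) (List.length-map shifted p)) p ⟩
          costAfter ℕ._≟_ shifted (const s) (λ p r → toℕ (timed B p r)) p
            ≡⟨ costAfter-toℕ shifted s (timed B) p ⟩
          costAfter Fin._≟_ shifted (const s) (timed B) p
            ≤⟨ costAfter-translate f (s + z) (const s) (const 0#) (timed B) p ⟩
          D {h} (const s) (const ((s + z) + 0#)) + costAfter Fin._≟_ f (const 0#) (timed B) p
            ≡⟨ cong (_+ costAfter Fin._≟_ f (const 0#) (timed B) p)
                 (trans (cong (λ x → D {h} (const s) (const x)) (+-identityʳ (s + z)))
                        (D-const h s 0≤z)) ⟩
          fromℕ h * z + costAfter Fin._≟_ f (const 0#) (timed B) p ∎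
          where
          open ≤-Reasoning
          a : List ℝ → ℝ → ℕ
          a q _ = toℕ (B (length q))

      simCost-≤ : simCost p ≤ ρ * (fromℕ h * z + opt h f p) + c
      simCost-≤ = begin
        simCost p
          ≡⟨ costAfter-map ℕ._≟_ shifted (const s) (λ _ _ → refl) p ⟨
        costAfter ℕ._≟_ id (const s) A (List.map shifted p)
          ≡⟨ cong (costAfter ℕ._≟_ id (const s) A) (List.reverse-involutive (List.map shifted p)) ⟨
        costAfter ℕ._≟_ id (const s) A (reverse σ)
          ≡⟨ ALG≡costAfter ℕ._≟_ A (const s) σ ⟨
        ALG ℕ._≟_ A (const s) σ
          ≤⟨ A-competitive σ ⟩
        ρ * OPT ℕ._≟_ 0 (const s) σ + c
          ≤⟨ +-monoˡ-≤ c (*-monoʳ-≤ 0≤ρ OPT-≤opt) ⟩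
        ρ * (fromℕ h * z + opt h f p) + c ∎
        where open ≤-Reasoning

  -- The servers used so far, in the order of their first use, each with its
  -- current position on the half line.
  Table : Set
  Table = List (ℕ × ℝ)

  serve : ℕ → ℝ → Table → Table
  serve n r []            = (n , r) ∷ []
  serve n r ((x , y) ∷ L) with n ℕ.≟ x
  ... | yes _ = (x , r) ∷ L
  ... | no  _ = (x , y) ∷ serve n r L

  slot : ∀ {m} → Table → Fin m → ℝ
  slot []            i       = 0#
  slot ((_ , y) ∷ L) zero    = y
  slot (_       ∷ L) (suc i) = slot L i

  located : ℝ → Table → ℕ → ℝ
  located z []            n = s
  located z ((x , y) ∷ L) n with n ℕ.≟ x
  ... | yes _ = (s + z) + y
  ... | no  _ = located z L n

  slot-serve : ∀ {m} n r L → length (serve n r L) ℕ.≤ m → ∃[ i ] slot {m} (serve n r L) i ≡ r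
  slot-serve n r []            (ℕ.s≤s le) = zero , refl
  slot-serve n r ((x , y) ∷ L) le with n ℕ.≟ x
  slot-serve n r ((x , y) ∷ L) (ℕ.s≤s le) | yes _ = zero , refl
  slot-serve n r ((x , y) ∷ L) (ℕ.s≤s le) | no  _ =
    let i , eq = slot-serve n r L le in suc i , eq

  located-serve : ∀ z n r L → located z (serve n r L) n ≡ (s + z) + r
  located-serve z n r [] with n ℕ.≟ n
  ... | yes _   = refl
  ... | no  n≢n = contradiction refl n≢n
  located-serve z n r ((x , y) ∷ L) with n ℕ.≟ x in eq
  ... | yes _ rewrite eq = refl
  ... | no  _ rewrite eq = located-serve z n r L

  located-serve-other : ∀ z {n j} r L → j ≢ n → located z (serve n r L) j ≡ located z L j
  located-serve-other z {n} {j} r [] j≢n with j ℕ.≟ n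
  ... | yes j≡n = contradiction j≡n j≢n
  ... | no  _   = refl
  located-serve-other z {n} {j} r ((x , y) ∷ L) j≢n with n ℕ.≟ x
  located-serve-other z {n} {j} r ((x , y) ∷ L) j≢n | yes refl with j ℕ.≟ x
  ... | yes j≡n = contradiction j≡n j≢n
  ... | no  _   = refl
  located-serve-other z {n} {j} r ((x , y) ∷ L) j≢n | no _ with j ℕ.≟ x
  ... | yes _ = refl
  ... | no  _ = located-serve-other z r L j≢n

  -- A server in the table moves equally far in the simulation and in its slot. A new one travels
  -- `z + r` from the source but only `r` from the end point, and the difference pays for the longer
  -- table. Dropped entries only lower the left side.
  D-serve : ∀ {m z} n r L → 0# ≤ z → 0# ≤ r →
    D {m} (slot L) (slot (serve n r L)) + z * fromℕ (length (serve n r L))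
      ≤ d (located z L n) ((s + z) + r) + z * fromℕ (length L)
  D-serve {m} {z} n r [] 0≤z 0≤r = subst
    (λ w → D {m} (slot []) (slot ((n , r) ∷ [])) + z * fromℕ 1 ≤ w + z * 0#)
    (sym (trans (cong (d s) (+-assoc s z r)) (d[x,x+w]≡w s (+-nonNeg 0≤z 0≤r)))) (new m)
    where
    new : ∀ m → D {m} (slot []) (slot ((n , r) ∷ [])) + z * fromℕ 1 ≤ (z + r) + z * 0#
    new zero = ≤-transport 0≤r (solve 2 (λ z r →
      (con 0 :+ z :* (con 1 :+ con 0)) :+ r := ((z :+ r) :+ z :* con 0) :+ con 0) refl z r)
    new (suc m) = ≤-reflexive (trans
      (cong (_+ z * fromℕ 1) (cong₂ _+_
        (trans (cong (d 0#) (sym (+-identityˡ r))) (d[x,x+w]≡w 0# 0≤r)) (D-refl {m} (slot []))))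
      (solve 2 (λ z r →
        (r :+ con 0) :+ z :* (con 1 :+ con 0) := (z :+ r) :+ z :* con 0) refl z r))
  D-serve n r ((x , y) ∷ L) 0≤z 0≤r with n ℕ.≟ x
  D-serve {zero} n r ((x , y) ∷ L) 0≤z 0≤r | yes _ = +-monoˡ-≤ _ nonNegative
  D-serve {suc m} {z} n r ((x , y) ∷ L) 0≤z 0≤r | yes _ =
    ≤-reflexive (cong (_+ z * fromℕ (suc (length L)))
      (trans (cong (d y r +_) (D-refl {m} (slot L)))
        (trans (+-identityʳ _) (sym (d-translate (s + z) y r)))))
  D-serve {zero} {z} n r ((x , y) ∷ L) 0≤z 0≤r | no _ =
    ≤-transport (D-serve {zero} n r L 0≤z 0≤r) (solve 4 (λ z l′ δ l →
      (con 0 :+ z :* (con 1 :+ l′)) :+ (δ :+ z :* l) :=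
      (δ :+ z :* (con 1 :+ l)) :+ (con 0 :+ z :* l′)) refl
      z (fromℕ (length (serve n r L))) (d (located z L n) ((s + z) + r)) (fromℕ (length L)))
  D-serve {suc m} {z} n r ((x , y) ∷ L) 0≤z 0≤r | no _ =
    ≤-transport (D-serve {m} n r L 0≤z 0≤r) (trans
      (cong (λ e → ((e + δₛ) + z * (1# + l′)) + (δ + z * l)) (d-refl y))
      (solve 5 (λ z l′ δ l δₛ →
        ((con 0 :+ δₛ) :+ z :* (con 1 :+ l′)) :+ (δ :+ z :* l) :=
        (δ :+ z :* (con 1 :+ l)) :+ (δₛ :+ z :* l′)) refl z l′ δ l δₛ))
    where
    l l′ δ δₛ : ℝ
    l  = fromℕ (length L)
    l′ = fromℕ (length (serve n r L))
    δ  = d (located z L n) ((s + z) + r)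
    δₛ = D {m} (slot L) (slot (serve n r L))

  module _ (f : ℝ → ℝ) (0≤f : ∀ r → 0# ≤ f r) where

    table : ℝ → List ℝ → Table
    table z []      = []
    table z (r ∷ p) = serve (decisions f z p r) (f r) (table z p)

    virtual : ∀ {m} → ℝ → List ℝ → Fin m → ℝ
    virtual z p = slot (table z p)

    -- The table loses no information, since a server missing from it is still at the source.
    configAfter-table : ∀ z p n →
      configAfter ℕ._≟_ (shifted f z) (const s) (decisions f z) p n ≡ located z (table z p) n
    configAfter-table z []      n = refl
    configAfter-table z (r ∷ p) n = [ same , other ]′ (toSum (n ℕ.≟ decisions f z p r))
      where
      F : ℕ → ℝ
      F = configAfter ℕ._≟_ (shifted f z) (const s) (decisions f z) p

      same : n ≡ decisions f z p r → _
      same refl = trans (move-self ℕ._≟_ F n (shifted f z r))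
        (sym (located-serve z n (f r) (table z p)))

      other : n ≢ decisions f z p r → _
      other n≢ = trans (move-other ℕ._≟_ F (shifted f z r) n≢)
        (trans (configAfter-table z p n) (sym (located-serve-other z (f r) (table z p) n≢)))

    -- A server leaving the source costs the simulated algorithm an extra z.
    travel-virtual : ∀ {m} z → 0# ≤ z → ∀ p →
      travel (virtual {m} z) p + z * fromℕ (length (table z p)) ≤ simCost f z p
    travel-virtual z 0≤z []      = ≤-reflexive (trans (+-identityˡ _) (zeroʳ z))
    travel-virtual {m} z 0≤z (r ∷ p) = ≤-transport
      (+-mono-≤ (travel-virtual {m} z 0≤z p)
        (subst (λ x → δₛ + z * l′ ≤ d x (shifted f z r) + z * l)
          (sym (configAfter-table z p (decisions f z p r)))
          (D-serve {m} (decisions f z p r) (f r) (table z p) 0≤z (0≤f r))))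
      (solve 6 (λ t δₛ zl′ c e zl →
        ((t :+ δₛ) :+ zl′) :+ (c :+ (e :+ zl)) := (c :+ e) :+ ((t :+ zl) :+ (δₛ :+ zl′)))
        refl (travel (virtual {m} z) p) δₛ (z * l′) (simCost f z p)
        (d (configAfter ℕ._≟_ (shifted f z) (const s) (decisions f z) p (decisions f z p r))
           (shifted f z r))
        (z * l))
      where
      l l′ δₛ : ℝ
      l  = fromℕ (length (table z p))
      l′ = fromℕ (length (table z (r ∷ p)))
      δₛ = D {m} (virtual z p) (virtual z (r ∷ p))

    travel-virtual-nonNeg : ∀ {m} z p → 0# ≤ travel (virtual {m} z) p
    travel-virtual-nonNeg {m} z p =
      ≤-trans (D-nonNeg {m} (virtual z []) (virtual z p)) (D≤travel (virtual {m} z) p)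

    -- To be used with κ = h/ε and ι = ε/h.  The constant c⁺ in the choice of z
    -- absorbs the additive constant c of the simulated algorithm; the optimal
    -- cost at the start of an epoch is κ z up to a constant.
    module Epochs (h : ℕ) .{{_ : NonZero h}} (m : ℕ) (ε κ ι : ℝ)
      (0≤ε : 0# ≤ ε) (0≤κ : 0# ≤ κ) (0≤ι : 0# ≤ ι) (κι≡1 : κ * ι ≡ 1#) (εκ≡h : ε * κ ≡ fromℕ h)
      (enough : ρ * fromℕ h + ρ * κ ≤ fromℕ m)
      where

      H : ℝ
      H = fromℕ h

      -- The request that would need server number `m + 1` already belongs to the new epoch.
      scale : List ℝ → ℝ
      scale []      = c⁺
      scale (r ∷ p) with length (table (scale p) (r ∷ p)) ℕ.≤? m
      ... | yes _ = scale p
      ... | no  _ = ι * opt h f (r ∷ p) + c⁺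

      scale-∷ : ∀ r p →
        (length (table (scale p) (r ∷ p)) ℕ.≤ m × scale (r ∷ p) ≡ scale p) ⊎
        (length (table (scale p) (r ∷ p)) ℕ.> m × scale (r ∷ p) ≡ ι * opt h f (r ∷ p) + c⁺)
      scale-∷ r p with length (table (scale p) (r ∷ p)) ℕ.≤? m
      ... | yes le = inj₁ (le , refl)
      ... | no ¬le = inj₂ (ℕ.≰⇒> ¬le , refl)

      -- At a restart this jumps to the outcome of replaying the whole history at the new scale.
      config : List ℝ → Fin m → ℝ
      config p = virtual (scale p) p

      enough-* : ∀ {z} → 0# ≤ z → ρ * (H * z) + ρ * (κ * z) ≤ fromℕ m * z
      enough-* {z} 0≤z = subst (_≤ fromℕ m * z)
        (solve 4 (λ ρ H κ z → (ρ :* H :+ ρ :* κ) :* z := ρ :* (H :* z) :+ ρ :* (κ :* z))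
          refl ρ H κ z)
        (*-monoˡ-≤ 0≤z enough)

      κ*[ι*x+y] : ∀ x y → κ * (ι * x + y) ≡ x + κ * y
      κ*[ι*x+y] x y = trans
        (solve 4 (λ κ ι x y → κ :* (ι :* x :+ y) := (κ :* ι) :* x :+ κ :* y) refl κ ι x y)
        (trans (cong (λ k → k * x + κ * y) κι≡1)
          (solve 3 (λ x κ y → con 1 :* x :+ κ :* y := x :+ κ :* y) refl x κ y))

      -- Equal to `κ * z` for the scale `z` chosen at a restart, so `κ * z` remembers the value from
      -- then.
      T : List ℝ → ℝ
      T p = opt h f p + κ * c⁺

      -- At least `m + 1` servers have left the source, so the simulation costs the travel plus
      -- `(m + 1) z`, and at most `ρ (h z + opt) + c`. By `enough`, `m z` covers `ρ h z` and
      -- `ρ κ z`; the remaining `z` will absorb `c`.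
      overflow : ∀ {z} p → c⁺ ≤ z → length (table z p) ℕ.> m →
        travel (virtual {m} z) p + ρ * (κ * z) + z ≤ ρ * opt h f p + c
      overflow {z} p c⁺≤z m< = ≤-transport
        (+-mono-≤ (+-mono-≤ (≤-trans
          (+-monoʳ-≤ (travel (virtual {m} z) p) (*-monoʳ-≤ 0≤z (fromℕ-mono-≤ m<)))
          (travel-virtual {m} z 0≤z p)) (simCost-≤ f z h 0≤z p)) (enough-* 0≤z))
        (solve 9 (λ t ρκz z M s ρ Hz o c →
          ((t :+ ρκz) :+ z) :+ ((s :+ (ρ :* (Hz :+ o) :+ c)) :+ M :* z) :=
          (ρ :* o :+ c) :+ (((t :+ z :* (con 1 :+ M)) :+ s) :+ (ρ :* Hz :+ ρκz)))
          refl (travel (virtual {m} z) p) (ρ * (κ * z)) z (fromℕ m) (simCost f z p) ρ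
          (H * z) (opt h f p) c)
        where
        0≤z : 0# ≤ z
        0≤z = ≤-trans 0≤c⁺ c⁺≤z

      c⁺≤restart : ∀ p → c⁺ ≤ ι * opt h f p + c⁺
      c⁺≤restart p = subst (_≤ ι * opt h f p + c⁺) (+-identityˡ c⁺)
        (+-monoˡ-≤ c⁺ (*-nonNeg 0≤ι (opt-nonNeg h f p)))

      -- At the new scale `ρ κ z` is at least `ρ opt`, so an overflow would force `z ≤ c`, against
      -- `c⁺ ≤ z`.
      restart-fits : ∀ p → length (table (ι * opt h f p + c⁺) p) ℕ.≤ m
      restart-fits p with length (table (ι * opt h f p + c⁺) p) ℕ.≤? m
      ... | yes le = le
      ... | no ¬le = contradiction z≤c (λ le → c⁺≰c (≤-trans (c⁺≤restart p) le))
        where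
        z : ℝ
        z = ι * opt h f p + c⁺

        z≤c : z ≤ c
        z≤c = ≤-transport
          (+-mono-≤
            (+-mono-≤ (overflow p (c⁺≤restart p) (ℕ.≰⇒> ¬le)) (travel-virtual-nonNeg {m} z p))
            (*-nonNeg 0≤ρ (*-nonNeg 0≤κ 0≤c⁺)))
          (trans
            (solve 6 (λ z ρ o c t k →
              z :+ (((ρ :* o :+ c) :+ t) :+ ρ :* k) :=
              c :+ ((t :+ ρ :* (o :+ k) :+ z) :+ con 0 :+ con 0))
              refl z ρ (opt h f p) c (travel (virtual {m} z) p) (κ * c⁺))
            (cong (λ k → c + (((travel (virtual {m} z) p + ρ * k) + z) + 0# + 0#))
              (sym (κ*[ι*x+y] (opt h f p) c⁺))))

      -- z is the scale of the current epoch, w the total movement so far.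
      record Invariant (p : List ℝ) (z w : ℝ) : Set where
        field
          fits    : length (table z p) ℕ.≤ m
          large   : c⁺ ≤ z
          bounded : κ * z ≤ T p
          work    : w ≤ (ρ * (κ * z) + ρ * (κ * z)) + travel (virtual {m} z) p

      open Invariant

      initially : Invariant [] c⁺ 0#
      initially = record
        { fits    = ℕ.z≤n
        ; large   = ≤-refl
        ; bounded = subst (_≤ T []) (+-identityˡ _) (+-monoˡ-≤ _ (opt-nonNeg h f []))
        ; work    = +-nonNeg (+-nonNeg 0≤ρκc⁺ 0≤ρκc⁺) ≤-refl
        }
        where
        0≤ρκc⁺ : 0# ≤ ρ * (κ * c⁺)
        0≤ρκc⁺ = *-nonNeg 0≤ρ (*-nonNeg 0≤κ 0≤c⁺)

      continue : ∀ {p z w} r → Invariant p z w → length (table z (r ∷ p)) ℕ.≤ m →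
        Invariant (r ∷ p) z (w + D {m} (virtual z p) (virtual z (r ∷ p)))
      continue {p} {z} {w} r inv le = record
        { fits    = le
        ; large   = large inv
        ; bounded = ≤-trans (bounded inv) (+-monoˡ-≤ _ (opt-mono h f r p))
        ; work    = ≤-trans (+-monoˡ-≤ _ (work inv)) (≤-reflexive (+-assoc _ _ _))
        }

      -- The old travel `t` occurs twice, as movement made and as the bound on the return. Two
      -- copies of `settled` turn it, with the old `2 ρ κ z`, into `2 ρ κ z′`: this is the
      -- telescoping.
      restart : ∀ {p z w} r → Invariant p z w → length (table z (r ∷ p)) ℕ.> m →
        let z′ = ι * opt h f (r ∷ p) + c⁺ in
        Invariant (r ∷ p) z′ (w + D {m} (virtual z p) (virtual z′ (r ∷ p)))
      restart {p} {z} {w} r inv m< = record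
        { fits    = restart-fits (r ∷ p)
        ; large   = c⁺≤restart (r ∷ p)
        ; bounded = ≤-reflexive κz′≡T
        ; work    = ≤-transport
            (+-mono-≤ (+-mono-≤ (work inv) return) (+-mono-≤ settled settled))
            (solve 6 (λ w δ x x′ t t′ →
              (w :+ δ) :+ ((((x :+ x) :+ t) :+ (t :+ t′)) :+ (x′ :+ x′)) :=
              ((x′ :+ x′) :+ t′) :+ ((w :+ δ) :+ ((t :+ x) :+ (t :+ x)))) refl
              w (D {m} (virtual z p) (virtual z′ (r ∷ p))) (ρ * (κ * z)) (ρ * (κ * z′)) t t′)
        }
        where
        z′ t t′ o : ℝ
        z′ = ι * opt h f (r ∷ p) + c⁺
        t  = travel (virtual {m} z) p
        t′ = travel (virtual {m} z′) (r ∷ p)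
        o  = opt h f (r ∷ p)

        κz′≡T : κ * z′ ≡ T (r ∷ p)
        κz′≡T = κ*[ι*x+y] o c⁺

        return : D {m} (virtual z p) (virtual z′ (r ∷ p)) ≤ t + t′
        return = ≤-trans (D-triangle {m} (virtual z p) (const 0#) (virtual z′ (r ∷ p)))
          (+-mono-≤ (subst (_≤ t) (D-sym {m} (const 0#) (virtual z p)) (D≤travel (virtual {m} z) p))
            (D≤travel (virtual {m} z′) (r ∷ p)))

        -- `overflow` includes the request `r`, which the old epoch did not serve; `travel-mono`
        -- removes it, and `c ≤ z` cancels the additive constant.
        settled : t + ρ * (κ * z) ≤ ρ * (κ * z′)
        settled = ≤-transport
          (+-mono-≤
            (+-mono-≤ (overflow (r ∷ p) (large inv) m<) (travel-mono (virtual {m} z) r p))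
            (+-mono-≤ (≤-trans c≤c⁺ (large inv)) (*-nonNeg 0≤ρ (*-nonNeg 0≤κ 0≤c⁺))))
          (trans
            (solve 8 (λ t x ρ o c t₁ z k →
              (t :+ x) :+ (((ρ :* o :+ c) :+ t₁) :+ (z :+ ρ :* k)) :=
              ρ :* (o :+ k) :+ (((t₁ :+ x :+ z) :+ t) :+ (c :+ con 0)))
              refl t (ρ * (κ * z)) ρ o c (travel (virtual {m} z) (r ∷ p)) z (κ * c⁺))
            (cong (λ k → ρ * k + (((travel (virtual {m} z) (r ∷ p) + ρ * (κ * z) + z) + t) + (c + 0#)))
              (sym κz′≡T)))

      invariant : ∀ p → Invariant p (scale p) (travel config p)
      invariant []      = initially
      invariant (r ∷ p) = [ kept , changed ]′ (scale-∷ r p)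
        where
        Next : ℝ → Set
        Next z = Invariant (r ∷ p) z (travel config p + D {m} (config p) (virtual z (r ∷ p)))

        kept : _ → Next (scale (r ∷ p))
        kept (le , eq) = subst Next (sym eq) (continue r (invariant p) le)

        changed : _ → Next (scale (r ∷ p))
        changed (m< , eq) = subst Next (sym eq) (restart r (invariant p) m<)

      config-serves : ∀ p r → ∃[ i ] config (r ∷ p) i ≡ f r
      config-serves p r = slot-serve (decisions f z p r) (f r) (table z p) (fits (invariant (r ∷ p)))
        where
        z : ℝ
        z = scale (r ∷ p)

      -- As `κ z ≤ T`, finished epochs contribute `2 ρ T`. The current one is bounded by its
      -- simulation, where `h z = ε κ z ≤ ε T` and `opt ≤ T`.
      travel-config : ∀ p → travel config p ≤ (fromℕ 3 + ε) * ρ * T p + c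
      travel-config p = begin
        travel config p
          ≤⟨ work (invariant p) ⟩
        (ρ * (κ * z) + ρ * (κ * z)) + travel (virtual {m} z) p
          ≤⟨ +-mono-≤ (+-mono-≤ ρκz≤ρT ρκz≤ρT)
               (≤-trans (x≤x+y (*-nonNeg 0≤z (0≤fromℕ (length (table z p)))))
                 (travel-virtual {m} z 0≤z p)) ⟩
        (ρ * T p + ρ * T p) + simCost f z p
          ≤⟨ +-monoʳ-≤ _ (simCost-≤ f z h 0≤z p) ⟩
        (ρ * T p + ρ * T p) + (ρ * (H * z + opt h f p) + c)
          ≤⟨ +-monoʳ-≤ _ (+-monoˡ-≤ c (*-monoʳ-≤ 0≤ρ (+-mono-≤ Hz≤εT o≤T))) ⟩
        (ρ * T p + ρ * T p) + (ρ * (ε * T p + T p) + c)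
          ≡⟨ solve 4 (λ ρ ε T c →
               (ρ :* T :+ ρ :* T) :+ (ρ :* (ε :* T :+ T) :+ c) :=
               ((con 1 :+ (con 1 :+ (con 1 :+ con 0))) :+ ε) :* ρ :* T :+ c)
               refl ρ ε (T p) c ⟩
        (fromℕ 3 + ε) * ρ * T p + c ∎
        where
        open ≤-Reasoning

        z : ℝ
        z = scale p

        0≤z : 0# ≤ z
        0≤z = ≤-trans 0≤c⁺ (large (invariant p))

        ρκz≤ρT : ρ * (κ * z) ≤ ρ * T p
        ρκz≤ρT = *-monoʳ-≤ 0≤ρ (bounded (invariant p))

        Hz≤εT : H * z ≤ ε * T p
        Hz≤εT = subst (_≤ ε * T p)
          (trans (sym (*-assoc ε κ z)) (cong (_* z) εκ≡h))
          (*-monoʳ-≤ 0≤ε (bounded (invariant p)))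

        o≤T : opt h f p ≤ T p
        o≤T = x≤x+y (*-nonNeg 0≤κ 0≤c⁺)

  -- Joining the two half lines.

  module _ (h : ℕ) .{{_ : NonZero h}} (m l : ℕ) (ε κ ι : ℝ)
    (0≤ε : 0# ≤ ε) (0≤κ : 0# ≤ κ) (0≤ι : 0# ≤ ι) (κι≡1 : κ * ι ≡ 1#) (εκ≡h : ε * κ ≡ fromℕ h)
    (enough : ρ * fromℕ h + ρ * κ ≤ fromℕ m)
    where

    module Right = Epochs positivePart 0≤positivePart h m ε κ ι 0≤ε 0≤κ 0≤ι κι≡1 εκ≡h enough
    module Left  = Epochs negativePart 0≤negativePart h m ε κ ι 0≤ε 0≤κ 0≤ι κι≡1 εκ≡h enough

    -- The left half line is simulated in mirrored form, hence the negation; the `l` spare servers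
    -- stay put.
    config : List ℝ → Fin (m ℕ.+ (m ℕ.+ l)) → ℝ
    config p = Right.config p ++ ((-_ ∘ Left.config p) ++ const 0#)

    -- Both sides serve every request, seen as one at 0 by the side it does not belong to; the side
    -- on which it lies serves its true position.
    config-serves : ∀ p r → ∃[ i ] config (r ∷ p) i ≡ r
    config-serves p r = [ right , left ]′ (total 0# r)
      where
      right : 0# ≤ r → _
      right 0≤r = let i , eq = Right.config-serves p r in
        i ↑ˡ (m ℕ.+ l) ,
        trans (lookup-++ˡ (Right.config (r ∷ p)) _ i) (trans eq (0≤x⇒x⊔0≡x 0≤r))

      left : r ≤ 0# → _
      left r≤0 = let i , eq = Left.config-serves p r in
        m ↑ʳ (i ↑ˡ l) ,
        trans (lookup-++ʳ (Right.config (r ∷ p)) _ (i ↑ˡ l))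
          (trans (lookup-++ˡ (-_ ∘ Left.config (r ∷ p)) (const 0#) i)
            (trans (cong -_ (trans eq (0≤x⇒x⊔0≡x (0≤-x r≤0)))) (-‿involutive r)))

    travel-config : ∀ p → travel config p ≡ travel Right.config p + travel Left.config p
    travel-config []      = sym (+-identityˡ 0#)
    travel-config (r ∷ p) = trans
      (cong₂ _+_ (travel-config p) (trans
        (D-++ (Right.config p) (Right.config (r ∷ p)) _ _)
        (cong (D (Right.config p) (Right.config (r ∷ p)) +_) (trans
          (D-++ (-_ ∘ Left.config p) (-_ ∘ Left.config (r ∷ p)) (const 0#) (const 0#))
          (trans
            (cong₂ _+_ (D-map d-neg (Left.config p) (Left.config (r ∷ p))) (D-refl {l} (const 0#)))
            (+-identityʳ _))))))
      (solve 4 (λ a b c e → (a :+ b) :+ (c :+ e) := (a :+ c) :+ (b :+ e)) refl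
        (travel Right.config p) (travel Left.config p)
        (D (Right.config p) (Right.config (r ∷ p))) (D (Left.config p) (Left.config (r ∷ p))))

    hk-competitive : HKServerCompetitive h (m ℕ.+ (m ℕ.+ l)) ((fromℕ 3 + ε) * ρ)
    hk-competitive C₀ = chase , λ D₀ → constant D₀ , bound D₀
      where
      chase : List ℝ → ℝ → Fin (m ℕ.+ (m ℕ.+ l))
      chase p r = proj₁ (config-serves p r)

      ϱ k : ℝ
      ϱ = (fromℕ 3 + ε) * ρ
      k = κ * c⁺

      0≤ϱ : 0# ≤ ϱ
      0≤ϱ = *-nonNeg (+-nonNeg (0≤fromℕ 3) 0≤ε) 0≤ρ

      -- Both players pay once for starting away from the virtual positions or from 0; `k` and `c`
      -- arise once per half line.
      constant : (Fin h → ℝ) → ℝ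
      constant D₀ = D C₀ (config []) + (ϱ * (D (const 0#) D₀ + (k + k)) + (c + c))

      bound : ∀ D₀ σ → ALG Fin._≟_ chase C₀ σ
        ≤ ϱ * OPT Fin._≟_ (i₀ h) D₀ σ + constant D₀
      bound D₀ σ = begin
        ALG Fin._≟_ chase C₀ σ
          ≡⟨ ALG≡costAfter Fin._≟_ chase C₀ σ ⟩
        costAfter Fin._≟_ id C₀ chase p
          ≤⟨ lazy-cost id C₀ chase config (λ p r → proj₂ (config-serves p r)) p ⟩
        P + travel config p
          ≡⟨ cong (P +_) (travel-config p) ⟩
        P + (travel Right.config p + travel Left.config p)
          ≤⟨ +-monoʳ-≤ P (+-mono-≤ (Right.travel-config p) (Left.travel-config p)) ⟩
        P + ((ϱ * (o⁺ + k) + c) + (ϱ * (o⁻ + k) + c))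
          ≡⟨ cong (P +_) (solve 5 (λ ϱ o⁺ o⁻ k c →
               (ϱ :* (o⁺ :+ k) :+ c) :+ (ϱ :* (o⁻ :+ k) :+ c) :=
               ϱ :* (o⁺ :+ o⁻) :+ (ϱ :* (k :+ k) :+ (c :+ c))) refl ϱ o⁺ o⁻ k c) ⟩
        P + (ϱ * (o⁺ + o⁻) + (ϱ * (k + k) + (c + c)))
          ≤⟨ +-monoʳ-≤ P (+-monoˡ-≤ _ (*-monoʳ-≤ 0≤ϱ (opt-parts h D₀ σ))) ⟩
        P + (ϱ * (δ + O) + (ϱ * (k + k) + (c + c)))
          ≡⟨ solve 6 (λ P ϱ δ O k c →
               P :+ (ϱ :* (δ :+ O) :+ (ϱ :* (k :+ k) :+ (c :+ c))) :=
               ϱ :* O :+ (P :+ (ϱ :* (δ :+ (k :+ k)) :+ (c :+ c)))) refl P ϱ δ O k c ⟩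
        ϱ * O + constant D₀ ∎
        where
        open ≤-Reasoning

        p : List ℝ
        p = reverse σ

        P δ O o⁺ o⁻ : ℝ
        P  = D C₀ (config [])
        δ  = D (const 0#) D₀
        O  = OPT Fin._≟_ (i₀ h) D₀ σ
        o⁺ = opt h positivePart p
        o⁻ = opt h negativePart p

-- Choosing the parameters and counting the servers.

module Line (R : RealNumbers) where
  open RealNumbers R
  open OrderedField R
  open Server (realLine R)
  open CommutativeRing commutativeRing using (*-identityˡ)

  recip-inverseˡ : ∀ x x≢0 → recip x x≢0 * x ≡ 1#
  recip-inverseˡ x x≢0 = proj₁ (proj₂ (invertible x x≢0))

  recip-nonNeg : ∀ {x} (0<x : 0# < x) → 0# ≤ recip x (0<⇒≢0 0<x)
  recip-nonNeg {x} 0<x@(0≤x , _) = y*x≡1⇒0≤y 0≤x (recip-inverseˡ x (0<⇒≢0 0<x))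

  0<fromℕ : ∀ n .{{_ : NonZero n}} → 0# < fromℕ n
  0<fromℕ (suc n) = 0≤fromℕ (suc n) , λ 0≡ → fromℕ[1+n]≰0 n (≤-reflexive (sym 0≡))

  even-split : ∀ {n k} → ℤ.+ 2 ℤ.* ℤ.+ n ℤ.≤ ℤ.+ k → ∃[ l ] n ℕ.+ (n ℕ.+ l) ≡ k
  even-split {n} {k} le
    with l , refl ← ℕ.m≤n⇒∃[o]m+o≡n
                      (ℤ.drop‿+≤+ (subst (ℤ._≤ ℤ.+ k) (sym (ℤ.pos-* 2 n)) le))
    = l , trans (sym (ℕ.+-assoc n n l))
                (cong (λ x → (n ℕ.+ x) ℕ.+ l) (sym (ℕ.+-identityʳ n)))

  hk-competitive-⌈⌉ : (s ρ : ℝ) → InfiniteServerCompetitive s ρ →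
    (h : ℕ) .{{_ : NonZero h}} (ε : ℝ) (0<ε : 0# < ε) →
    (m : ℤ) → (1# + recip ε (0<⇒≢0 0<ε)) * ρ * fromℕ h ≤ fromℤ m →
    (k : ℕ) → (ℤ.+ 2) ℤ.* m ℤ.≤ ℤ.+ k →
    HKServerCompetitive h k ((fromℕ 3 + ε) * ρ)
  hk-competitive-⌈⌉ s ρ (A , c , A-competitive) h ε 0<ε m enough k 2m≤k
    -- Since `ρ` is nonnegative, so is the integer `m`, which can thus count servers.
    with n , refl ← fromℤ-nonNeg⁻¹ m (≤-trans
                      (*-nonNeg (*-nonNeg (+-nonNeg 0≤1 (recip-nonNeg 0<ε))
                        (Simulation.0≤ρ R s ρ A c A-competitive)) (0≤fromℕ h)) enough)
    with l , refl ← even-split {n} {k} 2m≤k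
    -- With `κ = h/ε`, the bound on `m` reads `ρ h + ρ κ ≤ m`.
    = Simulation.hk-competitive R s ρ A c A-competitive h n l ε (e * fromℕ h) (ε * H⁻¹)
        (proj₁ 0<ε)
        (*-nonNeg (recip-nonNeg 0<ε) (0≤fromℕ h))
        (*-nonNeg (proj₁ 0<ε) (recip-nonNeg (0<fromℕ h)))
        (cancel (recip-inverseˡ ε (0<⇒≢0 0<ε)) (recip-inverseˡ (fromℕ h) (0<⇒≢0 (0<fromℕ h))))
        (cancel′ (recip-inverseˡ ε (0<⇒≢0 0<ε)))
        (subst (_≤ fromℕ n) (distribute e ρ (fromℕ h)) enough)
    where
    e H⁻¹ : ℝ
    e   = recip ε (0<⇒≢0 0<ε)
    H⁻¹ = recip (fromℕ h) (0<⇒≢0 (0<fromℕ h))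

    cancel : ∀ {e ε H H⁻¹} → e * ε ≡ 1# → H⁻¹ * H ≡ 1# → (e * H) * (ε * H⁻¹) ≡ 1#
    cancel {e} {ε} {H} {H⁻¹} eε≡1 H⁻¹H≡1 = trans
      (solve 4 (λ e H ε H⁻¹ → (e :* H) :* (ε :* H⁻¹) := (e :* ε) :* (H⁻¹ :* H)) refl e H ε H⁻¹)
      (trans (cong₂ _*_ eε≡1 H⁻¹H≡1) (*-identityˡ 1#))

    cancel′ : ∀ {e ε H} → e * ε ≡ 1# → ε * (e * H) ≡ H
    cancel′ {e} {ε} {H} eε≡1 = trans
      (solve 3 (λ e H ε → ε :* (e :* H) := (e :* ε) :* H) refl e H ε)
      (trans (cong (_* H) eε≡1) (*-identityˡ H))

    distribute : ∀ e ρ H → (1# + e) * ρ * H ≡ ρ * H + ρ * (e * H)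
    distribute = solve 3 (λ e ρ H →
      (con 1 :+ e) :* ρ :* H := ρ :* H :+ ρ :* (e :* H)) refl

theorem4 : (R : RealNumbers) →
    let open RealNumbers R
        open Server (realLine R) in
    (s ρ : ℝ) → InfiniteServerCompetitive s ρ →
    (h : ℕ) .{{_ : NonZero h}} (ε : ℝ) (ε>0 : 0# < ε) →
    (m : ℤ) → IsCeiling ((1# + recip ε (0<⇒≢0 ε>0)) * ρ * fromℕ h) m →
    (k : ℕ) → (ℤ.+ 2) ℤ.* m ℤ.≤ ℤ.+ k →
    HKServerCompetitive h k ((fromℕ 3 + ε) * ρ)
theorem4 R s ρ infinite h ε ε>0 m (enough , _) k 2m≤k =
  Line.hk-competitive-⌈⌉ R s ρ infinite h ε ε>0 m enough k 2m≤k
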